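{- There is a Boolean query definable by a first-order sentence of the form $\exists\vec x\,\forall\vec y\,\psi$ with $\psi$ quantifier-free which cannot be maintained by a $\mathrm{DynProp}$-program (of any arity).
   Context: Dynamic complexity framework. A dynamic schema is a pair $(\tau_{\mathrm{in}},\tau_{\mathrm{aux}})$ of an input schema and an auxiliary schema ($\tau_{\mathrm{aux}}$ consists of relation symbols only); put $\tau=\tau_{\mathrm{in}}\cup\tau_{\mathrm{aux}}$. A modification of a database over a finite domain $D$ is an insertion $\mathrm{ins}_S(\vec a)$ or a deletion $\mathrm{del}_S(\vec a)$ of a tuple $\vec a$ over $D$ into/from a relation $S\in\tau_{\mathrm{in}}$. An update program $P$ contains, for each $R\in\tau_{\mathrm{aux}}$ and each $\delta\in\{\mathrm{ins}_S,\mathrm{del}_S\}$, $S\in\tau_{\mathrm{in}}$, a formula $\varphi^R_\delta(\vec x;\vec y)$ over $\tau$ with $|\vec x|$ the arity of $S$ and $|\vec y|$ the arity of $R$. A program state is $(D,\mathcal I,\mathcal A)$ with input database $\mathcal I$ and auxiliary database $\mathcal A$ over $D$. Applying $\delta(\vec a)$ to a state $\mathcal S$ modifies the input database by $\delta(\vec a)$ and reinterprets each $R\in\tau_{\mathrm{aux}}$ as $\{\vec b:\mathcal S\models\varphi^R_\delta(\vec a;\vec b)\}$ (evaluated in the old state); sequences are applied one after another. A dynamic program $(P,\mathrm{Init},Q)$ has an arbitrary initialization mapping $\mathrm{Init}$ from input databases to auxiliary databases over the same domain and a designated query symbol $Q\in\tau_{\mathrm{aux}}$; it maintains a query $\mathcal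 Q$ if for every input database $\mathcal D$ over any finite domain and every sequence $\alpha$ of modifications, the value of $Q$ in the state reached from $(D,\mathcal D,\mathrm{Init}(\mathcal D))$ by applying $\alpha$ equals $\mathcal Q(\alpha(\mathcal D))$. A $\mathrm{DynProp}$-program is one whose update formulas are quantifier-free. -}

module Defs where

open import Data.Nat using (ℕ; zero; suc; _+_)
open import Data.Fin as Fin using (Fin; splitAt)
open import Data.Bool using (Bool; true; false; _∧_; _∨_; not; if_then_else_)
open import Data.Vec using (Vec; []; _∷_; lookup; map; _++_)
open import Data.Vec.Properties using (≡-dec)
open import Data.Sum using (_⊎_; inj₁; inj₂; [_,_]′)
open import Data.List using (List; []; _∷_)
open import Data.Product using (Σ; _,_; _×_)
open import Relation.Nullary using (yes; no; ¬_)
open import Relation.Nullary.Decidable using (⌊_⌋)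
open import Relation.Binary.PropositionalEquality using (_≡_; refl)

record Schema : Set where
  field
    size : ℕ
    ar   : Fin size → ℕ
open Schema public

Sym : Schema → Set
Sym σ = Fin (size σ)

_∪_ : Schema → Schema → Schema
σ ∪ ρ = record { size = size σ + size ρ
               ; ar   = λ i → [ ar σ , ar ρ ]′ (splitAt (size σ) i) }

Structure : Schema → ℕ → Set
Structure σ n = (R : Sym σ) → Vec (Fin n) (ar σ R) → Bool

private
  combine′ : ∀ {σ ρ n} → Structure σ n → Structure ρ n →
             (x : Fin (size σ) ⊎ Fin (size ρ)) →
             Vec (Fin n) ([ ar σ , ar ρ ]′ x) → Bool
  combine′ I A (inj₁ R) t = I R t
  combine′ I A (inj₂ R) t = A R t

_⊕_ : ∀ {σ ρ n} → Structure σ n → Structure ρ n → Structure (σ ∪ ρ) n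
_⊕_ {σ} I A i t = combine′ I A (splitAt (size σ) i) t

-- Formulas.  Variables are Fin v (de Bruijn style: a quantifier binds
-- variable 'zero' of Fin (suc v)).

data QF (σ : Schema) (v : ℕ) : Set where
  rel  : (R : Sym σ) → Vec (Fin v) (ar σ R) → QF σ v
  eq   : Fin v → Fin v → QF σ v
  ⊤f   : QF σ v
  ⊥f   : QF σ v
  ¬f   : QF σ v → QF σ v
  _∧f_ : QF σ v → QF σ v → QF σ v
  _∨f_ : QF σ v → QF σ v → QF σ v

data FO (σ : Schema) (v : ℕ) : Set where
  qf   : QF σ v → FO σ v
  ¬F   : FO σ v → FO σ v
  _∧F_ : FO σ v → FO σ v → FO σ v
  _∨F_ : FO σ v → FO σ v → FO σ v
  ∃F   : FO σ (suc v) → FO σ v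
  ∀F   : FO σ (suc v) → FO σ v

exs : ∀ {σ m} k → FO σ (k + m) → FO σ m
exs zero    φ = φ
exs (suc k) φ = exs k (∃F φ)

alls : ∀ {σ m} l → FO σ (l + m) → FO σ m
alls zero    φ = φ
alls (suc l) φ = alls l (∀F φ)

∃∀-sentence : ∀ {σ} k l → QF σ (l + (k + 0)) → FO σ 0
∃∀-sentence k l ψ = exs k (alls l (qf ψ))

anyFin : ∀ n → (Fin n → Bool) → Bool
anyFin zero    f = false
anyFin (suc n) f = f Fin.zero ∨ anyFin n (λ i → f (Fin.suc i))

allFin : ∀ n → (Fin n → Bool) → Bool
allFin zero    f = true
allFin (suc n) f = f Fin.zero ∧ allFin n (λ i → f (Fin.suc i))

evalQF : ∀ {σ n v} → Structure σ n → Vec (Fin n) v → QF σ v → Bool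
evalQF 𝒜 env (rel R xs) = 𝒜 R (map (lookup env) xs)
evalQF 𝒜 env (eq x y)   = ⌊ lookup env x Fin.≟ lookup env y ⌋
evalQF 𝒜 env ⊤f         = true
evalQF 𝒜 env ⊥f         = false
evalQF 𝒜 env (¬f φ)     = not (evalQF 𝒜 env φ)
evalQF 𝒜 env (φ ∧f ψ)   = evalQF 𝒜 env φ ∧ evalQF 𝒜 env ψ
evalQF 𝒜 env (φ ∨f ψ)   = evalQF 𝒜 env φ ∨ evalQF 𝒜 env ψ

evalFO : ∀ {σ n v} → Structure σ n → Vec (Fin n) v → FO σ v → Bool
evalFO 𝒜 env (qf φ)    = evalQF 𝒜 env φ
evalFO 𝒜 env (¬F φ)    = not (evalFO 𝒜 env φ)
evalFO 𝒜 env (φ ∧F ψ)  = evalFO 𝒜 env φ ∧ evalFO 𝒜 env ψ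
evalFO 𝒜 env (φ ∨F ψ)  = evalFO 𝒜 env φ ∨ evalFO 𝒜 env ψ
evalFO {n = n} 𝒜 env (∃F φ) = anyFin n (λ a → evalFO 𝒜 (a ∷ env) φ)
evalFO {n = n} 𝒜 env (∀F φ) = allFin n (λ a → evalFO 𝒜 (a ∷ env) φ)

BooleanQuery : Schema → Set
BooleanQuery σ = (n : ℕ) → Structure σ n → Bool

queryOf : ∀ {σ} → FO σ 0 → BooleanQuery σ
queryOf φ n 𝒟 = evalFO 𝒟 [] φ

data Kind : Set where
  ins del : Kind

record Modification (σ : Schema) (n : ℕ) : Set where
  constructor mod
  field
    kind  : Kind
    S     : Sym σ
    tuple : Vec (Fin n) (ar σ S)
open Modification public

kindValue : Kind → Bool
kindValue ins = true
kindValue del = false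

applyMod : ∀ {σ n} → Modification σ n → Structure σ n → Structure σ n
applyMod {n = n} (mod k S a) 𝒟 R t with R Fin.≟ S
... | no  _    = 𝒟 R t
... | yes refl = if ⌊ ≡-dec Fin._≟_ t a ⌋ then kindValue k else 𝒟 R t

applyMods : ∀ {σ n} → List (Modification σ n) → Structure σ n → Structure σ n
applyMods []       𝒟 = 𝒟
applyMods (δ ∷ α) 𝒟 = applyMods α (applyMod δ 𝒟)

-- An update program: for each auxiliary symbol R, each input symbol S
-- and each kind of modification (ins_S / del_S) a quantifier-free
-- formula φ^R_δ(x⃗; y⃗) over τ_in ∪ τ_aux with |x⃗| = ar S, |y⃗| = ar R.
-- Variables 0 … ar S - 1 are x⃗, the remaining ar R variables are y⃗.
UpdateProgram : Schema → Schema → Set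
UpdateProgram τin τaux =
  (R : Sym τaux) (k : Kind) (S : Sym τin) → QF (τin ∪ τaux) (ar τin S + ar τaux R)

record DynPropProgram (τin τaux : Schema) : Set where
  field
    update : UpdateProgram τin τaux
    init   : (n : ℕ) → Structure τin n → Structure τaux n
    Q      : Sym τaux
open DynPropProgram public

State : Schema → Schema → ℕ → Set
State τin τaux n = Structure τin n × Structure τaux n

step : ∀ {τin τaux n} → UpdateProgram τin τaux →
       Modification τin n → State τin τaux n → State τin τaux n
step P δ (I , A) =
  applyMod δ I ,
  (λ R b → evalQF (I ⊕ A) (tuple δ ++ b) (P R (kind δ) (S δ)))

run : ∀ {τin τaux n} → UpdateProgram τin τaux →
      List (Modification τin n) → State τin τaux n → State τin τaux n
run P []       s = s
run P (δ ∷ α) s = run P α (step P δ s)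

Maintains : ∀ {τin τaux} → DynPropProgram τin τaux → BooleanQuery τin → Set
Maintains {τin} {τaux} 𝒫 𝒬 =
  Σ (ar τaux (Q 𝒫) ≡ 0) λ Q0 →
  (n : ℕ) (𝒟 : Structure τin n) (α : List (Modification τin n)) →
    let (I , A) = run (update 𝒫) α (𝒟 , init 𝒫 n 𝒟)
    in A (Q 𝒫) (Q0-tuple Q0) ≡ 𝒬 n (applyMods α 𝒟)
  where
    Q0-tuple : ∀ {n k} → k ≡ 0 → Vec (Fin n) k
    Q0-tuple refl = []

DynPropMaintainable : ∀ {τin} → BooleanQuery τin → Set
DynPropMaintainable {τin} 𝒬 =
  Σ Schema λ τaux → Σ (DynPropProgram τin τaux) λ 𝒫 → Maintains 𝒫 𝒬

{-# OPTIONS --safe #-}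

-- Query: some b in B has its E-neighbourhood equal to U.  Fix k elements A and
-- add one element for each subset of A, joined by E to the members of that
-- subset; B selects a family of subsets of A, so there are 2^(2^k) inputs.
-- Updating U on A to a given subset makes the query ask whether this subset
-- belongs to the family.  A quantifier-free program that modifies only tuples
-- over A sees only the auxiliary relations restricted to A, that is, at most
-- c·k^m bits of the initialization.  For large k this is less than 2^k, so two
-- different families must receive the same answers.
module Submission where

open import Defs
open import Data.Bool using (Bool; true; false; _∧_; _∨_; not; if_then_else_)
open import Data.Bool.Properties using (⇔→≡; ∨-zeroʳ)
open import Data.Fin as Fin using (Fin; zero; suc; _↑ˡ_; _↑ʳ_; splitAt; combine; remQuot; finToFun; funToFin; fromℕ<)
open import Data.Fin.Patterns
open import Data.Fin.Properties
  using (2↔Bool; splitAt-↑ˡ; splitAt-↑ʳ; splitAt⁻¹-↑ˡ; remQuot-combine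
        ; finToFun-funToFin; funToFin-finToFin; <⇒notInjective)
open import Data.List as List using (List; []; _∷_)
open import Data.List.Extrema.Nat using (max; xs≤max)
open import Data.List.Membership.Propositional using (_∈_)
open import Data.List.Membership.Propositional.Properties using (∈-allFin; ∈-tabulate⁺)
open import Data.List.Relation.Unary.All as All using ()
open import Data.List.Relation.Unary.Any using (here; there)
open import Data.Nat using (ℕ; zero; suc; _+_; _*_; _^_; _≤_; _<_; z≤n; s≤s)
open import Data.Nat.Properties
open import Data.Product using (Σ; ∃-syntax; _×_; _,_; proj₁; proj₂)
open import Data.Sum using (_⊎_; inj₁; inj₂; [_,_]′)
open import Data.Vec as Vec using (Vec; []; _∷_; lookup; map; tabulate; truncate; padRight)
open import Data.Vec.Properties
  using (≡-dec; map-∘; map-cong; map-++; lookup-map; tabulate-cong; tabulate∘lookup; truncate-padRight)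
open import Function using (_∘_; const; _⇔_; mk⇔; Inverse; Injective)
open import Function.Bundles using (module Equivalence; module Injection)
open import Function.Properties.Inverse using (↔⇒↣)
open import Relation.Nullary using (¬_; yes; no; contradiction)
open import Relation.Nullary.Decidable using (⌊_⌋)
open import Relation.Binary.PropositionalEquality

-- Structures that agree on part of the domain

Agree : ∀ {σ k n} → (Fin k → Fin n) → Structure σ n → Structure σ n → Set
Agree e 𝒜 ℬ = ∀ R t → 𝒜 R (map e t) ≡ ℬ R (map e t)

agree-⊕ : ∀ {σ ρ k n} {e : Fin k → Fin n} {I I′ : Structure σ n} {A A′ : Structure ρ n} →
          Agree {σ} e I I′ → Agree {ρ} e A A′ → Agree {σ ∪ ρ} e (I ⊕ A) (I′ ⊕ A′)
agree-⊕ {σ} I∼I′ A∼A′ R with splitAt (size σ) R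
... | inj₁ S = I∼I′ S
... | inj₂ S = A∼A′ S

-- Without quantifiers, evaluation reads only tuples of values of the variables, and these all lie
-- in the image of `e`. This is where quantifier-freeness of the update formulas enters.
evalQF-agree : ∀ {σ k n v} {e : Fin k → Fin n} {𝒜 ℬ : Structure σ n} → Agree {σ} e 𝒜 ℬ →
               (env : Vec (Fin k) v) (φ : QF σ v) →
               evalQF 𝒜 (map e env) φ ≡ evalQF ℬ (map e env) φ
evalQF-agree {e = e} {𝒜} {ℬ} 𝒜∼ℬ env (rel R xs) =
  trans (cong (𝒜 R) map-lookup) (trans (𝒜∼ℬ R _) (cong (ℬ R) (sym map-lookup)))
  where
  map-lookup : map (lookup (map e env)) xs ≡ map e (map (lookup env) xs)
  map-lookup = trans (map-cong (λ i → lookup-map i e env) xs) (map-∘ e (lookup env) xs)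
evalQF-agree 𝒜∼ℬ env (eq x y) = refl
evalQF-agree 𝒜∼ℬ env ⊤f       = refl
evalQF-agree 𝒜∼ℬ env ⊥f       = refl
evalQF-agree 𝒜∼ℬ env (¬f φ)   = cong not (evalQF-agree 𝒜∼ℬ env φ)
evalQF-agree 𝒜∼ℬ env (φ ∧f ψ) = cong₂ _∧_ (evalQF-agree 𝒜∼ℬ env φ) (evalQF-agree 𝒜∼ℬ env ψ)
evalQF-agree 𝒜∼ℬ env (φ ∨f ψ) = cong₂ _∨_ (evalQF-agree 𝒜∼ℬ env φ) (evalQF-agree 𝒜∼ℬ env ψ)

applyMod-agree : ∀ {σ k n} {e : Fin k → Fin n} {𝒟 𝒟′ : Structure σ n} (δ : Modification σ n) →
                 Agree {σ} e 𝒟 𝒟′ → Agree {σ} e (applyMod δ 𝒟) (applyMod δ 𝒟′)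
applyMod-agree {e = e} (mod κ S a) 𝒟∼𝒟′ R t with R Fin.≟ S
... | no  _    = 𝒟∼𝒟′ R t
... | yes refl = cong (if ⌊ ≡-dec Fin._≟_ (map e t) a ⌋ then kindValue κ else_) (𝒟∼𝒟′ R t)

mapMod : ∀ {σ k n} → (Fin k → Fin n) → Modification σ k → Modification σ n
mapMod e (mod κ S a) = mod κ S (map e a)

-- The modifications come from `Fin k`, so every update formula gets its parameters in the image of
-- `e`; the new auxiliary bits there depend only on the old input and auxiliary bits there.
run-agree : ∀ {τin τaux k n} {e : Fin k → Fin n} (P : UpdateProgram τin τaux)
            (α : List (Modification τin k)) {I I′ : Structure τin n} {A A′ : Structure τaux n} →
            Agree {τin} e I I′ → Agree {τaux} e A A′ →
            Agree {τaux} e (proj₂ (run P (List.map (mapMod e) α) (I , A)))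
                           (proj₂ (run P (List.map (mapMod e) α) (I′ , A′)))
run-agree P [] I∼I′ A∼A′ = A∼A′
run-agree {τin} {τaux} {e = e} P (mod κ S a ∷ α) {I} {I′} {A} {A′} I∼I′ A∼A′ =
  run-agree P α (applyMod-agree (mod κ S (map e a)) I∼I′) update-agree
  where
  update-agree : Agree {τaux} e (proj₂ (step P (mod κ S (map e a)) (I , A)))
                                (proj₂ (step P (mod κ S (map e a)) (I′ , A′)))
  -- The assignment `map e a ++ map e b` becomes the image of a single tuple over `Fin k`.
  update-agree R b rewrite sym (map-++ e a b) =
    evalQF-agree (agree-⊕ I∼I′ A∼A′) (a Vec.++ b) (P R κ S)

-- Counting restrictions of structures

maxArity : Schema → ℕ
maxArity σ = max 0 (List.tabulate (ar σ))

ar≤maxArity : ∀ σ (R : Sym σ) → ar σ R ≤ maxArity σ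
ar≤maxArity σ R = All.lookup (xs≤max 0 (List.tabulate (ar σ))) (∈-tabulate⁺ R)

funToFin-cong : ∀ {m n} {f g : Fin m → Fin n} → f ≗ g → funToFin f ≡ funToFin g
funToFin-cong {zero}  f≗g = refl
funToFin-cong {suc m} f≗g = cong₂ combine (f≗g zero) (funToFin-cong (f≗g ∘ suc))

-- One coding of sets by numbers serves subsets of A, families of such subsets and restrictions of
-- auxiliary structures, so the final pigeonhole is between two types `Fin`.
encodeSet : ∀ {m} → (Fin m → Bool) → Fin (2 ^ m)
encodeSet χ = funToFin (Inverse.from 2↔Bool ∘ χ)

decodeSet : ∀ {m} → Fin (2 ^ m) → Fin m → Bool
decodeSet c = Inverse.to 2↔Bool ∘ finToFun c

decode-encode : ∀ {m} (χ : Fin m → Bool) → decodeSet (encodeSet χ) ≗ χ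
decode-encode χ i =
  trans (cong (Inverse.to 2↔Bool) (finToFun-funToFin _ i)) (Inverse.strictlyInverseˡ 2↔Bool (χ i))

encodeSet-injective : ∀ {m} {χ χ′ : Fin m → Bool} → encodeSet χ ≡ encodeSet χ′ → χ ≗ χ′
encodeSet-injective {χ = χ} {χ′} same-code i =
  trans (sym (decode-encode χ i)) (trans (cong (λ c → decodeSet c i) same-code) (decode-encode χ′ i))

decodeSet-injective : ∀ {m} {c d : Fin (2 ^ m)} → decodeSet {m} c ≗ decodeSet d → c ≡ d
decodeSet-injective {m} {c} {d} c≗d =
  trans (sym (funToFin-finToFin {m} c))
    (trans (funToFin-cong {m} (Injection.injective (↔⇒↣ 2↔Bool) ∘ c≗d)) (funToFin-finToFin {m} d))

module _ {σ : Schema} {k n : ℕ} (e : Fin k → Fin n) where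

  -- Padding every tuple to length maxArity σ gives one index set for all relations.
  bitAt : Structure σ n → Sym σ × Fin (k ^ maxArity σ) → Bool
  bitAt 𝒜 (R , c) = 𝒜 R (map e (truncate (ar≤maxArity σ R) (tabulate (finToFun c))))

  restrictionCode : Structure σ n → Fin (2 ^ (size σ * k ^ maxArity σ))
  restrictionCode 𝒜 = encodeSet (bitAt 𝒜 ∘ remQuot {size σ} (k ^ maxArity σ))

  -- Each tuple is the truncation of its padding to length `maxArity σ`, so its bit occurs in the
  -- code. The element of `Fin k` is the padding.
  restrictionCode-agree : Fin k → ∀ {𝒜 ℬ} → restrictionCode 𝒜 ≡ restrictionCode ℬ → Agree {σ} e 𝒜 ℬ
  restrictionCode-agree x {𝒜} {ℬ} same-code R t = subst (λ u → 𝒜 R (map e u) ≡ ℬ R (map e u)) decode bits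
    where
    padded : Vec (Fin k) (maxArity σ)
    padded = padRight (ar≤maxArity σ R) x t

    c : Fin (k ^ maxArity σ)
    c = funToFin (lookup padded)

    decode : truncate (ar≤maxArity σ R) (tabulate (finToFun c)) ≡ t
    decode = trans
      (cong (truncate _) (trans (tabulate-cong (finToFun-funToFin (lookup padded))) (tabulate∘lookup padded)))
      (truncate-padRight (ar≤maxArity σ R) x t)

    bits : bitAt 𝒜 (R , c) ≡ bitAt ℬ (R , c)
    bits = subst (λ p → bitAt 𝒜 p ≡ bitAt ℬ p) (remQuot-combine R c)
      (encodeSet-injective same-code (combine R c))

-- With `k = 2 ^ j` and `s < 2 ^ s` it suffices that `s + j * m ≤ 2 ^ j`.
polynomial<exponential : ∀ s m → ∃[ k ] 0 < k × s * k ^ m < 2 ^ k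
polynomial<exponential s m = k , m^n>0 2 j , bound
  where
  open ≤-Reasoning
  i j k : ℕ
  -- Since `j` is `i + i`, the power `2 ^ j` is the square of `2 ^ i` and exceeds `i + i * i`; this
  -- `i` bounds both `s` and `m + m`.
  i = s + (m + m)
  j = i + i
  k = 2 ^ j

  n<2^n : ∀ n → n < 2 ^ n
  n<2^n zero    = s≤s z≤n
  n<2^n (suc n) = begin-strict
    suc n           ≡⟨ +-comm 1 n ⟩
    n + 1           <⟨ +-mono-<-≤ (n<2^n n) (m^n>0 2 n) ⟩
    2 ^ n + 2 ^ n   ≡⟨ cong (2 ^ n +_) (sym (+-identityʳ (2 ^ n))) ⟩
    2 ^ suc n       ∎

  exponent≤k : s + j * m ≤ k
  exponent≤k = begin
    s + (i + i) * m       ≡⟨ cong (s +_) (trans (*-distribʳ-+ m i i) (sym (*-distribˡ-+ i m m))) ⟩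
    s + i * (m + m)       ≤⟨ +-mono-≤ (m≤m+n s (m + m)) (*-monoʳ-≤ i (m≤n+m (m + m) s)) ⟩
    i + i * i             ≡⟨⟩
    suc i * i             ≤⟨ *-monoʳ-≤ (suc i) (n≤1+n i) ⟩
    suc i * suc i         ≤⟨ *-mono-≤ (n<2^n i) (n<2^n i) ⟩
    2 ^ i * 2 ^ i         ≡⟨ ^-distribˡ-+-* 2 i i ⟨
    k                     ∎

  bound : s * k ^ m < 2 ^ k
  bound = begin-strict
    s * k ^ m             ≡⟨ cong (s *_) (^-*-assoc 2 j m) ⟩
    s * 2 ^ (j * m)       <⟨ *-monoˡ-< (2 ^ (j * m)) {{m^n≢0 2 (j * m)}} (n<2^n s) ⟩
    2 ^ s * 2 ^ (j * m)   ≡⟨ ^-distribˡ-+-* 2 s (j * m) ⟨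
    2 ^ (s + j * m)       ≤⟨ ^-monoʳ-≤ 2 exponent≤k ⟩
    2 ^ k                 ∎

-- The query and its hard instances

anyFin⇔ : ∀ {n} {f : Fin n → Bool} → anyFin n f ≡ true ⇔ (∃[ i ] f i ≡ true)
anyFin⇔ = mk⇔ to from
  where
  to : ∀ {n} {f : Fin n → Bool} → anyFin n f ≡ true → ∃[ i ] f i ≡ true
  to {suc n} {f} h with f 0F in fx
  ... | true  = 0F , fx
  ... | false = let i , fi = to h in suc i , fi
  from : ∀ {n} {f : Fin n → Bool} → ∃[ i ] f i ≡ true → anyFin n f ≡ true
  from (0F    , fi) rewrite fi = refl
  from {suc n} {f} (suc i , fi) rewrite from {n} {f ∘ suc} (i , fi) = ∨-zeroʳ (f 0F)

allFin⇔ : ∀ {n} {f : Fin n → Bool} → allFin n f ≡ true ⇔ (∀ i → f i ≡ true)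
allFin⇔ = mk⇔ to from
  where
  to : ∀ {n} {f : Fin n → Bool} → allFin n f ≡ true → ∀ i → f i ≡ true
  to {suc n} {f} h i with f 0F in fx
  to h 0F      | true = fx
  to h (suc i) | true = to h i
  from : ∀ {n} {f : Fin n → Bool} → (∀ i → f i ≡ true) → allFin n f ≡ true
  from {zero}  h = refl
  from {suc n} h rewrite h 0F = from (h ∘ suc)

pattern B = 0F
pattern E = 1F
pattern U = 2F

BEU : Schema
BEU = record { size = 3 ; ar = λ { B → 1 ; E → 2 ; U → 1 } }

_↔f_ : ∀ {σ v} → QF σ v → QF σ v → QF σ v
φ ↔f χ = (φ ∧f χ) ∨f (¬f φ ∧f ¬f χ)

-- Variable 0 is universally and variable 1 existentially quantified.
someNeighbourhoodIsU : QF BEU (1 + (1 + 0))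
someNeighbourhoodIsU = rel B (1F ∷ []) ∧f (rel E (1F ∷ 0F ∷ []) ↔f rel U (0F ∷ []))

𝒬 : BooleanQuery BEU
𝒬 = queryOf (∃∀-sentence 1 1 someNeighbourhoodIsU)

iff-true⇔≡ : ∀ {x y} → (x ∧ y) ∨ (not x ∧ not y) ≡ true ⇔ x ≡ y
iff-true⇔≡ {true}  {true}  = mk⇔ (λ _ → refl) (λ _ → refl)
iff-true⇔≡ {true}  {false} = mk⇔ (λ ()) (λ ())
iff-true⇔≡ {false} {true}  = mk⇔ (λ ()) (λ ())
iff-true⇔≡ {false} {false} = mk⇔ (λ _ → refl) (λ _ → refl)

∧-true⇔ : ∀ {x y} → x ∧ y ≡ true ⇔ (x ≡ true × y ≡ true)
∧-true⇔ {true}  = mk⇔ (λ h → refl , h) proj₂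
∧-true⇔ {false} = mk⇔ (λ ()) (λ ())

𝒬-true⇔ : ∀ {n} (𝒟 : Structure BEU n) → 𝒬 n 𝒟 ≡ true ⇔
  (∃[ b ] 𝒟 B (b ∷ []) ≡ true × ∀ a → 𝒟 E (b ∷ a ∷ []) ≡ 𝒟 U (a ∷ []))
𝒬-true⇔ 𝒟 = mk⇔ to′ from′
  where
  open Equivalence
  to′ : _
  to′ h with b , hb ← to anyFin⇔ h =
    -- `B` stands under the universal quantifier; it is read off at the instance `b`.
    b , proj₁ (to ∧-true⇔ (to allFin⇔ hb b)) , λ a → to iff-true⇔≡ (proj₂ (to ∧-true⇔ (to allFin⇔ hb a)))
  from′ : _
  from′ (b , inB , E≡U) =
    from anyFin⇔ (b , from allFin⇔ λ a → from ∧-true⇔ (inB , from iff-true⇔≡ (E≡U a)))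

-- Writing a set into `U` by modifications

kindOf : Bool → Kind
kindOf true  = ins
kindOf false = del

kindValue-kindOf : ∀ b → kindValue (kindOf b) ≡ b
kindValue-kindOf true  = refl
kindValue-kindOf false = refl

module _ {k n} (e : Fin k → Fin n) (χ : Fin k → Bool) where

  setU : Fin k → Modification BEU k
  setU x = mod (kindOf (χ x)) U (x ∷ [])

  setAllU : List (Fin k) → Structure BEU n → Structure BEU n
  setAllU xs = applyMods (List.map (mapMod e) (List.map setU xs))

  setAllU-B : ∀ xs 𝒟 t → setAllU xs 𝒟 B t ≡ 𝒟 B t
  setAllU-B []       𝒟 t = refl
  setAllU-B (x ∷ xs) 𝒟 t = setAllU-B xs _ t

  setAllU-E : ∀ xs 𝒟 t → setAllU xs 𝒟 E t ≡ 𝒟 E t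
  setAllU-E []       𝒟 t = refl
  setAllU-E (x ∷ xs) 𝒟 t = setAllU-E xs _ t

  module _ (χ̂ : Fin n → Bool) (extends : χ̂ ∘ e ≗ χ) where

    setU-U : ∀ x (𝒟 : Structure BEU n) y → y ≡ e x ⊎ 𝒟 U (y ∷ []) ≡ χ̂ y →
             applyMod (mapMod e (setU x)) 𝒟 U (y ∷ []) ≡ χ̂ y
    setU-U x 𝒟 y h with ≡-dec Fin._≟_ (y ∷ []) (e x ∷ []) | h
    ... | yes refl | _         = trans (kindValue-kindOf (χ x)) (sym (extends x))
    ... | no y≢ex  | inj₁ refl = contradiction refl y≢ex
    ... | no _     | inj₂ Uy   = Uy

    -- Induction invariant: either `y` is still to be written, or `U` at `y` already has its final
    -- value, which later updates preserve.
    setAllU-U : ∀ xs (𝒟 : Structure BEU n) y → (∃[ x ] x ∈ xs × y ≡ e x) ⊎ 𝒟 U (y ∷ []) ≡ χ̂ y →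
                setAllU xs 𝒟 U (y ∷ []) ≡ χ̂ y
    setAllU-U []       𝒟 y (inj₂ Uy) = Uy
    setAllU-U (x ∷ xs) 𝒟 y (inj₁ (_ , here refl , y≡ex)) =
      setAllU-U xs _ y (inj₂ (setU-U x 𝒟 y (inj₁ y≡ex)))
    setAllU-U (x ∷ xs) 𝒟 y (inj₁ (z , there z∈xs , y≡ez)) =
      setAllU-U xs _ y (inj₁ (z , z∈xs , y≡ez))
    setAllU-U (x ∷ xs) 𝒟 y (inj₂ Uy) =
      setAllU-U xs _ y (inj₂ (setU-U x 𝒟 y (inj₂ Uy)))

-- The domain consists of the elements A and the codes of all subsets of A.
module SubsetFamilies (k : ℕ) where

  private
    N : ℕ
    N = 2 ^ k

  A↪ : Fin k → Fin (k + N)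
  A↪ = _↑ˡ N

  -- Codes have no incoming edges, so `U` can equal a neighbourhood while staying empty outside A,
  -- where the updates do not reach.
  edge : Fin k ⊎ Fin N → Fin k ⊎ Fin N → Bool
  edge (inj₁ _) = const false
  edge (inj₂ s) = [ decodeSet s , const false ]′

  familyDB : (Fin N → Bool) → Structure BEU (k + N)
  familyDB F B (x ∷ [])     = [ const false , F ]′ (splitAt k x)
  familyDB F E (x ∷ y ∷ []) = edge (splitAt k x) (splitAt k y)
  familyDB F U _            = false

  -- The family enters only through `B` on codes, outside A.
  familyDB-agree : ∀ F F′ → Agree {BEU} A↪ (familyDB F) (familyDB F′)
  familyDB-agree F F′ B (x ∷ [])     rewrite splitAt-↑ˡ k x N = refl
  familyDB-agree F F′ E (x ∷ y ∷ []) = refl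
  familyDB-agree F F′ U _            = refl

  probe : Fin N → List (Modification BEU k)
  probe s = List.map (setU A↪ (decodeSet s)) (List.allFin k)

  module _ (F : Fin N → Bool) (s : Fin N) where

    private
      𝒟 : Structure BEU (k + N)
      𝒟 = applyMods (List.map (mapMod A↪) (probe s)) (familyDB F)

    probed-U : ∀ y → 𝒟 U (y ∷ []) ≡ edge (inj₂ s) (splitAt k y)
    probed-U y = setAllU-U A↪ (decodeSet s) (edge (inj₂ s) ∘ splitAt k)
      (λ x → cong (edge (inj₂ s)) (splitAt-↑ˡ k x N)) (List.allFin k) (familyDB F) y covered
      where
      covered : (∃[ x ] x ∈ List.allFin k × y ≡ A↪ x) ⊎ false ≡ edge (inj₂ s) (splitAt k y)
      covered with splitAt k y in split
      ... | inj₁ x = inj₁ (x , ∈-allFin x , sym (splitAt⁻¹-↑ˡ split))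
      ... | inj₂ _ = inj₂ refl

    probed-E : ∀ x y → 𝒟 E (x ∷ y ∷ []) ≡ edge (splitAt k x) (splitAt k y)
    probed-E x y = setAllU-E A↪ (decodeSet s) (List.allFin k) (familyDB F) (x ∷ y ∷ [])

    probed-B : ∀ x → 𝒟 B (x ∷ []) ≡ [ const false , F ]′ (splitAt k x)
    probed-B x = setAllU-B A↪ (decodeSet s) (List.allFin k) (familyDB F) (x ∷ [])

    -- A witness in `B` is some code `s′`; its row equals `U`, so `s′` and `s` decode to the same
    -- subset and coincide. Conversely the element for `s` is a witness.
    probe-answer : 𝒬 (k + N) 𝒟 ≡ F s
    probe-answer = ⇔→≡ {z = true} (mk⇔ (sound ∘ Equivalence.to (𝒬-true⇔ 𝒟)) (Equivalence.from (𝒬-true⇔ 𝒟) ∘ complete))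
      where
      sound : ∃[ b ] 𝒟 B (b ∷ []) ≡ true × (∀ a → 𝒟 E (b ∷ a ∷ []) ≡ 𝒟 U (a ∷ [])) → F s ≡ true
      sound (b , inB , E≡U) = go (splitAt k b) (trans (sym (probed-B b)) inB)
        λ a → trans (sym (probed-E b a)) (trans (E≡U a) (probed-U a))
        where
        go : ∀ b′ → [ const false , F ]′ b′ ≡ true →
             (∀ a → edge b′ (splitAt k a) ≡ edge (inj₂ s) (splitAt k a)) → F s ≡ true
        -- No case for `b` in A arises, as `B` is false there.
        go (inj₂ s′) Fs′ same = subst (λ c → F c ≡ true) (decodeSet-injective {k} equal) Fs′
          where
          equal : decodeSet {k} s′ ≗ decodeSet s
          equal a = subst (λ a′ → edge (inj₂ s′) a′ ≡ edge (inj₂ s) a′) (splitAt-↑ˡ k a N) (same (A↪ a))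

      complete : F s ≡ true → ∃[ b ] 𝒟 B (b ∷ []) ≡ true × (∀ a → 𝒟 E (b ∷ a ∷ []) ≡ 𝒟 U (a ∷ []))
      complete Fs = k ↑ʳ s ,
        trans (probed-B (k ↑ʳ s)) (trans (cong [ const false , F ]′ (splitAt-↑ʳ k N s)) Fs) ,
        λ a → trans (probed-E (k ↑ʳ s) a)
          (trans (cong (λ b → edge b (splitAt k a)) (splitAt-↑ʳ k N s)) (sym (probed-U a)))

-- Pigeonhole on the initial auxiliary structures

agree-nullary : ∀ {σ k n} {e : Fin k → Fin n} {𝒜 ℬ : Structure σ n} → Agree {σ} e 𝒜 ℬ →
                ∀ R → ar σ R ≡ 0 → ∀ t → 𝒜 R t ≡ ℬ R t
agree-nullary {σ} {𝒜 = 𝒜} {ℬ} 𝒜∼ℬ R nullary t =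
  subst (λ u → 𝒜 R u ≡ ℬ R u) (unique nullary _ t) (𝒜∼ℬ R (subst (Vec _) (sym nullary) []))
  where
  unique : ∀ {X : Set} {r} → r ≡ 0 → (u v : Vec X r) → u ≡ v
  unique refl [] [] = refl

not-maintainable : ¬ DynPropMaintainable 𝒬
not-maintainable (τ , 𝒫 , Q-nullary , correct) =
  let k , 0<k , few = polynomial<exponential (size τ) (maxArity τ)
  -- Exponentiating `few` once more gives fewer codes than the `2 ^ (2 ^ k)` families.
  in <⇒notInjective (^-monoʳ-< 2 (s≤s (s≤s z≤n)) few) (initCode-injective k 0<k)
  where
  module _ (k : ℕ) (0<k : 0 < k) where
    open SubsetFamilies k

    n : ℕ
    n = k + 2 ^ k

    family : Fin (2 ^ (2 ^ k)) → Structure BEU n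
    family c = familyDB (decodeSet c)

    initialAux : Fin (2 ^ (2 ^ k)) → Structure τ n
    initialAux c = init 𝒫 n (family c)

    initCode : Fin (2 ^ (2 ^ k)) → Fin (2 ^ (size τ * k ^ maxArity τ))
    initCode c = restrictionCode {τ} A↪ (initialAux c)

    probeA : Fin (2 ^ k) → List (Modification BEU n)
    probeA s = List.map (mapMod A↪) (probe s)

    finalAux : Fin (2 ^ (2 ^ k)) → Fin (2 ^ k) → Structure τ n
    finalAux c s = proj₂ (run (update 𝒫) (probeA s) (family c , initialAux c))

    -- Equal codes force equal answers to all probes, and the probe for `s` reads off the bit of the
    -- family at `s`.
    initCode-injective : Injective _≡_ _≡_ initCode
    initCode-injective {c} {d} same-code = decodeSet-injective {2 ^ k} λ s → begin
      decodeSet c s                                  ≡⟨ probe-answer (decodeSet c) s ⟨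
      𝒬 n (applyMods (probeA s) (family c))          ≡⟨ correct n (family c) (probeA s) ⟨
      finalAux c s (Q 𝒫) _                           ≡⟨ same-answer s _ ⟩
      finalAux d s (Q 𝒫) _                           ≡⟨ correct n (family d) (probeA s) ⟩
      𝒬 n (applyMods (probeA s) (family d))          ≡⟨ probe-answer (decodeSet d) s ⟩
      decodeSet d s                                  ∎
      where
      open ≡-Reasoning

      same-initialAux : Agree {τ} A↪ (initialAux c) (initialAux d)
      same-initialAux = restrictionCode-agree {τ} A↪ (fromℕ< 0<k) {initialAux c} {initialAux d} same-code

      same-answer : ∀ s t → finalAux c s (Q 𝒫) t ≡ finalAux d s (Q 𝒫) t
      same-answer s = agree-nullary {τ} {e = A↪} {finalAux c s} {finalAux d s}
        (run-agree (update 𝒫) (probe s) {family c} {family d} {initialAux c} {initialAux d}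
          (familyDB-agree (decodeSet c) (decodeSet d)) same-initialAux)
        (Q 𝒫) Q-nullary

theorem5p8 : Σ Schema λ τin → Σ ℕ λ k → Σ ℕ λ l →
    Σ (QF τin (l + (k + 0))) λ ψ →
    ¬ DynPropMaintainable (queryOf (∃∀-sentence k l ψ))
theorem5p8 = BEU , 1 , 1 , someNeighbourhoodIsU , not-maintainable
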